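{- The FIFO policy is not $c$-competitive for any constant $c$ in the online linear tape sequencing problem (online LTS).
   Context: Tape. A tape is a set of files $\mathscr F=\{1,\dots,n\}$ stored contiguously, in index order from left to right, on a line. File $i$ has size $s_i$ (a positive integer number of bits), left position $\ell_i$ and right position $r_i=\ell_i+s_i$, with $\ell_1=0$, $\ell_{i+1}=r_i$, and tape length $L=r_n=\sum_i s_i$. The tape head starts at position $L$ at time $0$ and moves at (at most) unit speed in either direction. A file is read by moving the head from $\ell_i$ to $r_i$ (left to right). Online LTS. Requests for files become available over time: each request has a file and a release time, and an online policy learns of a request only at its release time. A request for file $i$ is serviced by a reading of $i$ that starts (head at $\ell_i$) at or after its release time. The response time of a request is the time elapsed from the beginning of operations (time $0$) until the reading servicing it starts. The objective is to minimize the sum of the response times of all requests. A policy is $c$-competitive if, on every instance, its objective value is at most $c$ times the minimum objective value attainable offline (knowing all requests and release times in advance, but still servicing each request only at or after its release). FIFO (first-in first-out) policy: services the requests in the order of their arrival (requests arriving simultaneously are ordered by their arbitrary submission order). -}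

module Defs where

open import Data.Fin using (Fin; zero; suc)
import Data.Fin as Fin
import Data.Fin.Properties as Fin
open import Data.Nat using (ℕ; zero; suc)
import Data.Nat as ℕ
import Data.Nat.Coprimality as Coprimality
open import Data.Product using (_×_; _,_; proj₁; proj₂; ∃-syntax)
open import Data.Rational
open import Data.Rational.Properties
open import Data.Rational.Solver using (module +-*-Solver)
open import Data.Sum using (_⊎_; inj₁; inj₂)
open import Data.Vec.Functional using (Vector; foldr; tail)
open import Relation.Binary.PropositionalEquality
open import Relation.Nullary using (yes; no; contradiction)
open import Relation.Nullary.Decidable using (_×-dec_)

open +-*-Solver using (solve; _:+_; _:-_; :-_; _:=_)

fromℕ : ℕ → ℚ
fromℕ n = mkℚ+ n 1 (Coprimality.sym (Coprimality.1-coprimeTo n))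

sum : ∀ {n} → Vector ℚ n → ℚ
sum = foldr _+_ 0ℚ

------------------------------------------------------------------------
-- Tapes

record Tape : Set where
  field
    #files : ℕ
    size   : Vector ℕ #files
    size>0 : ∀ i → 0 ℕ.< size i

  File : Set
  File = Fin #files

sizesBefore : ∀ {n} → Vector ℕ n → Fin n → ℕ
sizesBefore s zero    = 0
sizesBefore s (suc i) = s zero ℕ.+ sizesBefore (tail s) i

module _ (T : Tape) where
  open Tape T

  width left right : File → ℚ
  width i = fromℕ (size i)
  left  i = fromℕ (sizesBefore size i)
  right i = left i + width i

  tapeLength : ℚ
  tapeLength = fromℕ (foldr ℕ._+_ 0 size)

  -- A reading of i starts at time t: from then on the head moves strictly
  -- rightwards until it reaches the right end of i.  Strictness rules out a
  -- head that waits at the left end after the reading has "started".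
  Reads : (ℚ → ℚ) → File → ℚ → Set
  Reads head i t = ∃[ e ] (t ≤ e × head t ≡ left i × head e ≡ right i ×
    (∀ {u v} → t ≤ u → u < v → v ≤ e → head u < head v))

------------------------------------------------------------------------
-- Instances and schedules

-- Requests are numbered in their order of arrival, simultaneous ones in
-- submission order; hence the release times are nondecreasing.

record Instance : Set where
  field
    tape         : Tape
    #requests    : ℕ
    file         : Vector (Tape.File tape) #requests
    release      : Vector ℚ #requests
    release≥0    : ∀ k → 0ℚ ≤ release k
    release-mono : ∀ {j k} → j Fin.≤ k → release j ≤ release k

-- A motion of the head, its position being a function of time, together
-- with the start of the reading that services each request.  Several
-- requests may be serviced by one reading.

record Schedule (I : Instance) : Set where
  open Instance I
  field
    head             : ℚ → ℚ
    head-initial     : head 0ℚ ≡ tapeLength tape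
    head-speed       : ∀ {t u} → 0ℚ ≤ t → t ≤ u → ∣ head u - head t ∣ ≤ u - t
    service          : Vector ℚ #requests
    service-released : ∀ k → release k ≤ service k
    service-reads    : ∀ k → Reads tape head (file k) (service k)

  -- Response times are measured from time 0, not from the release.
  objective : ℚ
  objective = sum service

-- What a policy does on an instance.  It need not be online; that fifo
-- below is, can be read off its definition: the head only departs for a
-- request after the release.

Policy : Set
Policy = (I : Instance) → Schedule I

-- Being at most c times the offline minimum is being at most c times the
-- objective of every schedule: schedules need not be online.

Competitive : ℚ → Policy → Set
Competitive c P = ∀ I (S : Schedule I) →
  Schedule.objective (P I) ≤ c * Schedule.objective S

------------------------------------------------------------------------
-- The rule followed by FIFO

module _ (T : Tape) where
  open Tape T

  data Status : Set where
    initial : Status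
    reading : (i : File) (start : ℚ) → Status  -- the most recent reading

  -- Where the head becomes free for the next request, and when.
  place free : Status → ℚ
  place initial       = tapeLength T
  place (reading i a) = right T i
  free initial        = 0ℚ
  free (reading i a)  = a + width T i

  -- The head stays where it is until a request is known, and then travels
  -- at full speed.
  depart arrive : Status → File → ℚ → ℚ
  depart σ i ρ = free σ ⊔ ρ
  arrive σ i ρ = depart σ i ρ + ∣ place σ - left T i ∣

  -- The start of the reading servicing the next request, for file i with
  -- release time ρ.  Servicing in arrival order, this can be the most
  -- recent reading, if that is a reading of i that started no earlier
  -- than ρ; otherwise a new reading is made.
  start : Status → File → ℚ → ℚ
  start initial       i ρ = arrive initial i ρ
  start (reading j a) i ρ with j Fin.≟ i ×-dec ρ ≤? a
  ... | yes _ = a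
  ... | no  _ = arrive (reading j a) i ρ

  next : Status → File → ℚ → Status
  next σ i ρ = reading i (start σ i ρ)

  fifoService : ∀ {m} → Status → Vector File m → Vector ℚ m → Vector ℚ m
  fifoService σ f r zero    = start σ (f zero) (r zero)
  fifoService σ f r (suc k) =
    fifoService (next σ (f zero) (r zero)) (tail f) (tail r) k

------------------------------------------------------------------------
-- Functions of time with slope at most 1 in absolute value

Slow : ℚ → (ℚ → ℚ) → Set
Slow x f = ∀ {t u} → x ≤ t → t ≤ u →
  f u ≤ f t + (u - t) × f t ≤ f u + (u - t)

0≤diff : ∀ {p q} → p ≤ q → 0ℚ ≤ q - p
0≤diff {p} {q} p≤q = subst (_≤ q - p) (+-inverseʳ p) (+-monoˡ-≤ (- p) p≤q)

p≤p+q : ∀ p {q} → 0ℚ ≤ q → p ≤ p + q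
p≤p+q p {q} 0≤q = subst (_≤ p + q) (+-identityʳ p) (+-monoʳ-≤ p 0≤q)

0≤fromℕ : ∀ n → 0ℚ ≤ fromℕ n
0≤fromℕ n = nonNegative⁻¹ (fromℕ n)

moveˡ : ∀ {p q d} → p ≤ q + d → p - q ≤ d
moveˡ {p} {q} {d} h = subst (p - q ≤_)
  (solve 2 (λ q d → (q :+ d) :- q := d) refl q d) (+-monoˡ-≤ (- q) h)

ahead : ∀ l w y t v → l + w ≤ y + (t + w - v) → l + (v - t) ≤ y
ahead l w y t v h = subst (_≤ y)
  (solve 4 (λ l w t v →
    (l :+ w) :- ((t :+ w) :- v) := l :+ (v :- t)) refl l w t v)
  (moveˡ (subst (l + w ≤_) (+-comm y (t + w - v)) h))

slow⇒∣∣ : ∀ {x f t u} → Slow x f → x ≤ t → t ≤ u → ∣ f u - f t ∣ ≤ u - t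
slow⇒∣∣ {f = f} {t} {u} s x≤t t≤u with ∣p∣≡p∨∣p∣≡-p (f u - f t)
... | inj₁ e rewrite e = moveˡ (proj₁ (s x≤t t≤u))
... | inj₂ e rewrite e = subst (_≤ u - t)
  (solve 2 (λ p q → q :- p := :- (p :- q)) refl (f u) (f t))
  (moveˡ (proj₂ (s x≤t t≤u)))

slow-const : ∀ {x} p → Slow x (λ _ → p)
slow-const p _ t≤u = p≤p+q p (0≤diff t≤u) , p≤p+q p (0≤diff t≤u)

slow-elapsed : ∀ {x} d → Slow x (λ t → t - d)
slow-elapsed d {t} {u} _ t≤u = ≤-reflexive e ,
  ≤-trans (p≤p+q _ 0≤) (≤-trans (≤-reflexive (sym e)) (p≤p+q _ 0≤))
  where
  0≤ = 0≤diff t≤u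
  e : u - d ≡ (t - d) + (u - t)
  e = solve 3 (λ d t u → u :- d := (t :- d) :+ (u :- t)) refl d t u

slow-+ : ∀ {x f} p → Slow x f → Slow x (λ t → p + f t)
slow-+ {f = f} p s {t} {u} x≤t t≤u =
  shift (f u) (f t) (proj₁ (s x≤t t≤u)) , shift (f t) (f u) (proj₂ (s x≤t t≤u))
  where
  shift : ∀ q q′ {d} → q ≤ q′ + d → p + q ≤ (p + q′) + d
  shift q q′ {d} h =
    ≤-trans (+-monoʳ-≤ p h) (≤-reflexive (sym (+-assoc p q′ d)))

slow-rise : ∀ {x} p d → Slow x (λ t → p + (t - d))
slow-rise p d = slow-+ p (slow-elapsed d)

slow-fall : ∀ {x} p d → Slow x (λ t → p - (t - d))
slow-fall p d {t} {u} _ t≤u =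
  ≤-trans (p≤p+q _ 0≤) (≤-trans (≤-reflexive (sym e)) (p≤p+q _ 0≤)) ,
  ≤-reflexive e
  where
  0≤ = 0≤diff t≤u
  e : p - (t - d) ≡ (p - (u - d)) + (u - t)
  e = solve 4 (λ p d t u →
    p :- (t :- d) := (p :- (u :- d)) :+ (u :- t)) refl p d t u

slow-⊔ : ∀ {x f g} → Slow x f → Slow x g → Slow x (λ t → f t ⊔ g t)
slow-⊔ {f = f} {g} s s′ {t} {u} x≤t t≤u =
  shift (f u) (f t) (g u) (g t) (proj₁ (s x≤t t≤u)) (proj₁ (s′ x≤t t≤u)) ,
  shift (f t) (f u) (g t) (g u) (proj₂ (s x≤t t≤u)) (proj₂ (s′ x≤t t≤u))
  where
  shift : ∀ p p′ q q′ {d} → p ≤ p′ + d → q ≤ q′ + d → p ⊔ q ≤ (p′ ⊔ q′) + d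
  shift p p′ q q′ {d} h k = ⊔-lub
    (≤-trans h (+-monoˡ-≤ d (p≤p⊔q p′ q′)))
    (≤-trans k (+-monoˡ-≤ d (p≤q⊔p p′ q′)))

slow-⊓ : ∀ {x f g} → Slow x f → Slow x g → Slow x (λ t → f t ⊓ g t)
slow-⊓ {f = f} {g} s s′ {t} {u} x≤t t≤u =
  shift (f u) (f t) (g u) (g t) (proj₁ (s x≤t t≤u)) (proj₁ (s′ x≤t t≤u)) ,
  shift (f t) (f u) (g t) (g u) (proj₂ (s x≤t t≤u)) (proj₂ (s′ x≤t t≤u))
  where
  shift : ∀ p p′ q q′ {d} → p ≤ p′ + d → q ≤ q′ + d → p ⊓ q ≤ (p′ ⊓ q′) + d
  shift p p′ q q′ h k with ⊓-sel p′ q′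
  ... | inj₁ e rewrite e = ≤-trans (p⊓q≤p p q) h
  ... | inj₂ e rewrite e = ≤-trans (p⊓q≤q p q) k

-- f up to and including time a, and g afterwards.
switch : ℚ → (ℚ → ℚ) → (ℚ → ℚ) → ℚ → ℚ
switch a f g t with t ≤? a
... | yes _ = f t
... | no  _ = g t

switch-before : ∀ {a f g t} → t ≤ a → switch a f g t ≡ f t
switch-before {a} {t = t} t≤a with t ≤? a
... | yes _  = refl
... | no t≰a = contradiction t≤a t≰a

switch-after : ∀ {a f g t} → f a ≡ g a → a ≤ t → switch a f g t ≡ g t
switch-after {a} {f} {g} {t} e a≤t with t ≤? a
... | no  _   = refl
... | yes t≤a = subst (λ x → f x ≡ g x) (≤-antisym a≤t t≤a) e

slow-trans : ∀ p q r a t u →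
  p ≤ q + (u - a) → q ≤ r + (a - t) → p ≤ r + (u - t)
slow-trans p q r a t u h k = ≤-trans h
  (≤-trans (+-monoˡ-≤ (u - a) k) (≤-reflexive
    (solve 4 (λ r a t u → (r :+ (a :- t)) :+ (u :- a) := r :+ (u :- t))
      refl r a t u)))

slow-trans′ : ∀ p q r a t u →
  p ≤ q + (a - t) → q ≤ r + (u - a) → p ≤ r + (u - t)
slow-trans′ p q r a t u h k = ≤-trans h
  (≤-trans (+-monoˡ-≤ (a - t) k) (≤-reflexive
    (solve 4 (λ r a t u → (r :+ (u :- a)) :+ (a :- t) := r :+ (u :- t))
      refl r a t u)))

slow-switch : ∀ {x a f g} → f a ≡ g a →
  Slow x f → Slow a g → Slow x (switch a f g)
slow-switch {x} {a} {f} {g} e sf sg {t} {u} x≤t t≤u with t ≤? a | u ≤? a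
... | yes _   | yes _   = sf x≤t t≤u
... | no t≰a  | no _    = sg (<⇒≤ (≰⇒> t≰a)) t≤u
... | no t≰a  | yes u≤a = contradiction (≤-trans t≤u u≤a) t≰a
... | yes t≤a | no u≰a  with sf x≤t t≤a | sg ≤-refl (<⇒≤ (≰⇒> u≰a))
...   | h , k | h′ , k′ =
  slow-trans (g u) (f a) (f t) a t u (subst (λ y → g u ≤ y + (u - a)) (sym e) h′) h ,
  slow-trans′ (f t) (f a) (g u) a t u k (subst (_≤ g u + (u - a)) (sym e) k′)

-- Travel at full speed from p, left at time d, to q: for t ≥ d, this is the
-- point nearest to q within distance t - d of p.
travel : ℚ → ℚ → ℚ → ℚ → ℚ
travel p q d t = (p - (t - d)) ⊔ (q ⊓ (p + (t - d)))

slow-travel : ∀ {x} p q d → Slow x (travel p q d)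
slow-travel p q d =
  slow-⊔ (slow-fall p d) (slow-⊓ (slow-const q) (slow-rise p d))

travel-depart : ∀ p q d → travel p q d d ≡ p
travel-depart p q d rewrite +-inverseʳ d | +-identityʳ p =
  trans (cong (p ⊔_) (⊓-comm q p)) (⊔-absorbs-⊓ p q)

d+y-d≡y : ∀ d y → (d + y) - d ≡ y
d+y-d≡y = solve 2 (λ d y → (d :+ y) :- d := y) refl

travel-arrive : ∀ p q d → travel p q d (d + ∣ p - q ∣) ≡ q
travel-arrive p q d =
  trans (cong (λ τ → (p - τ) ⊔ (q ⊓ (p + τ))) (d+y-d≡y d ∣ p - q ∣))
    (meet ∣ p - q ∣ (0≤∣p∣ (p - q)) (∣p∣≡p∨∣p∣≡-p (p - q)))
  where
  meet : ∀ τ → 0ℚ ≤ τ → τ ≡ p - q ⊎ τ ≡ - (p - q) →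
    (p - τ) ⊔ (q ⊓ (p + τ)) ≡ q
  meet τ _ (inj₁ e) =
    trans (cong (_⊔ (q ⊓ (p + τ))) (trans (cong (_-_ p) e)
      (solve 2 (λ p q → p :- (p :- q) := q) refl p q)))
      (⊔-absorbs-⊓ q _)
  meet τ 0≤τ (inj₂ e) =
    trans (cong (λ y → (p - τ) ⊔ (q ⊓ y)) p+τ≡q)
      (trans (cong ((p - τ) ⊔_) (⊓-idem q)) (p≤q⇒p⊔q≡q (≤-trans
        (moveˡ (subst (p ≤_) (+-comm p τ) (p≤p+q p 0≤τ)))
        (subst (p ≤_) p+τ≡q (p≤p+q p 0≤τ)))))
    where
    p+τ≡q : p + τ ≡ q
    p+τ≡q = trans (cong (p +_) e)
      (solve 2 (λ p q → p :+ (:- (p :- q)) := q) refl p q)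

------------------------------------------------------------------------
-- The motion of the head under FIFO

module _ (T : Tape) where
  open Tape T

  -- The motion, from the beginning of the most recent reading on, when no
  -- request is left to service.
  rest : Status T → ℚ → ℚ
  rest initial       t = tapeLength T
  rest (reading i a) t = left T i + ((t - a) ⊓ width T i)

  goRead : Status T → File → ℚ → (ℚ → ℚ) → ℚ → ℚ
  goRead σ i ρ onwards =
    switch d (rest σ) (switch (arrive T σ i ρ) (travel (place T σ) (left T i) d)
      onwards)
    where d = depart T σ i ρ

  fifoHead : ∀ {m} → Status T → Vector File m → Vector ℚ m → ℚ → ℚ
  fifoHead {zero}  σ f r = rest σ
  fifoHead {suc m} initial f r =
    goRead initial (f zero) (r zero)
      (fifoHead (next T initial (f zero) (r zero)) (tail f) (tail r))
  fifoHead {suc m} (reading j a) f r with j Fin.≟ f zero ×-dec r zero ≤? a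
  ... | yes _ = fifoHead (reading j a) (tail f) (tail r)
  ... | no  _ =
    goRead (reading j a) (f zero) (r zero)
      (fifoHead (reading (f zero) (arrive T (reading j a) (f zero) (r zero)))
        (tail f) (tail r))

  begin : Status T → ℚ
  begin initial       = 0ℚ
  begin (reading i a) = a

  begin≤free : ∀ σ → begin σ ≤ free T σ
  begin≤free initial       = ≤-refl
  begin≤free (reading i a) = p≤p+q a (0≤fromℕ (size i))

  free≤depart : ∀ σ i ρ → free T σ ≤ depart T σ i ρ
  free≤depart σ i ρ = p≤p⊔q (free T σ) ρ

  depart≤arrive : ∀ σ i ρ → depart T σ i ρ ≤ arrive T σ i ρ
  depart≤arrive σ i ρ = p≤p+q _ (0≤∣p∣ (place T σ - left T i))

  rest-free : ∀ σ {t} → free T σ ≤ t → rest σ t ≡ place T σ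
  rest-free initial       _ = refl
  rest-free (reading i a) {t} h = cong (left T i +_)
    (p≥q⇒p⊓q≡q (subst (_≤ t - a)
      (d+y-d≡y a (width T i))
      (+-monoˡ-≤ (- a) h)))

  rest-begin : ∀ i a → rest (reading i a) a ≡ left T i
  rest-begin i a = trans
    (cong (λ y → left T i + (y ⊓ width T i)) (+-inverseʳ a))
    (trans (cong (λ y → left T i + y) (p≤q⇒p⊓q≡p (0≤fromℕ (size i))))
      (+-identityʳ (left T i)))

  slow-rest : ∀ {x} σ → Slow x (rest σ)
  slow-rest initial       = slow-const _
  slow-rest (reading i a) =
    slow-+ (left T i) (slow-⊓ (slow-elapsed a) (slow-const (width T i)))

  module _ σ i ρ (onwards : ℚ → ℚ)
           (onwards-left : onwards (arrive T σ i ρ) ≡ left T i) where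

    private
      tr = travel (place T σ) (left T i) (depart T σ i ρ)

      join₂ : tr (arrive T σ i ρ) ≡ onwards (arrive T σ i ρ)
      join₂ = trans (travel-arrive (place T σ) (left T i) (depart T σ i ρ))
        (sym onwards-left)

      join₁ : rest σ (depart T σ i ρ) ≡
        switch (arrive T σ i ρ) tr onwards (depart T σ i ρ)
      join₁ = trans (rest-free σ (free≤depart σ i ρ))
        (sym (trans (switch-before {f = tr} {g = onwards} (depart≤arrive σ i ρ))
          (travel-depart (place T σ) (left T i) (depart T σ i ρ))))

    goRead-rest : ∀ {t} → t ≤ free T σ → goRead σ i ρ onwards t ≡ rest σ t
    goRead-rest h = switch-before (≤-trans h (free≤depart σ i ρ))

    goRead-onwards : ∀ {t} → arrive T σ i ρ ≤ t →
      goRead σ i ρ onwards t ≡ onwards t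
    goRead-onwards h = trans
      (switch-after join₁ (≤-trans (depart≤arrive σ i ρ) h))
      (switch-after join₂ h)

    slow-goRead : ∀ {x} → Slow (arrive T σ i ρ) onwards →
      Slow x (goRead σ i ρ onwards)
    slow-goRead s = slow-switch join₁ (slow-rest σ)
      (slow-switch join₂
        (slow-travel (place T σ) (left T i) (depart T σ i ρ)) s)

  fifoHead-rest : ∀ {m} σ (f : Vector File m) r {t} →
    t ≤ free T σ → fifoHead σ f r t ≡ rest σ t

  fifoHead-begin : ∀ {m} i a (f : Vector File m) r →
    fifoHead (reading i a) f r a ≡ left T i
  fifoHead-begin i a f r =
    trans (fifoHead-rest (reading i a) f r (begin≤free (reading i a)))
      (rest-begin i a)

  -- The motion once the first request has been given a reading of its own.
  onward : ∀ {m} → Status T → Vector File (suc m) → Vector ℚ (suc m) → ℚ → ℚ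
  onward σ f r = fifoHead (reading (f zero) (arrive T σ (f zero) (r zero)))
    (tail f) (tail r)

  onward-left : ∀ {m} σ (f : Vector File (suc m)) r →
    onward σ f r (arrive T σ (f zero) (r zero)) ≡ left T (f zero)
  onward-left σ f r = fifoHead-begin (f zero) (arrive T σ (f zero) (r zero))
    (tail f) (tail r)

  fifoHead-rest {zero}  σ f r h = refl
  fifoHead-rest {suc m} initial f r h =
    goRead-rest initial (f zero) (r zero)
      (onward initial f r) (onward-left initial f r) h
  fifoHead-rest {suc m} (reading j a) f r h with j Fin.≟ f zero ×-dec r zero ≤? a
  ... | yes _ = fifoHead-rest (reading j a) (tail f) (tail r) h
  ... | no  _ = goRead-rest (reading j a) (f zero) (r zero)
      (onward (reading j a) f r) (onward-left (reading j a) f r) h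

  slow-fifoHead : ∀ {m x} σ (f : Vector File m) r → Slow x (fifoHead σ f r)
  slow-onward : ∀ {m x} σ (f : Vector File (suc m)) r → Slow x (onward σ f r)

  slow-onward σ f r = slow-fifoHead
    (reading (f zero) (arrive T σ (f zero) (r zero))) (tail f) (tail r)

  slow-fifoHead {zero}  σ f r = slow-rest σ
  slow-fifoHead {suc m} initial f r =
    slow-goRead initial (f zero) (r zero)
      (onward initial f r) (onward-left initial f r)
      (slow-onward initial f r)
  slow-fifoHead {suc m} (reading j a) f r with j Fin.≟ f zero ×-dec r zero ≤? a
  ... | yes _ = slow-fifoHead (reading j a) (tail f) (tail r)
  ... | no  _ = slow-goRead (reading j a) (f zero) (r zero)
      (onward (reading j a) f r) (onward-left (reading j a) f r)
      (slow-onward (reading j a) f r)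

  begin≤start : ∀ σ i ρ → begin σ ≤ start T σ i ρ
  begin≤start initial       i ρ =
    ≤-trans (free≤depart initial i ρ) (depart≤arrive initial i ρ)
  begin≤start (reading j a) i ρ with j Fin.≟ i ×-dec ρ ≤? a
  ... | yes _ = ≤-refl
  ... | no  _ = ≤-trans (begin≤free (reading j a))
    (≤-trans (free≤depart (reading j a) i ρ) (depart≤arrive (reading j a) i ρ))

  release≤start : ∀ σ i ρ → ρ ≤ start T σ i ρ
  release≤start initial       i ρ =
    ≤-trans (p≤q⊔p (free T initial) ρ) (depart≤arrive initial i ρ)
  release≤start (reading j a) i ρ with j Fin.≟ i ×-dec ρ ≤? a
  ... | yes (_ , h) = h
  ... | no  _ = ≤-trans (p≤q⊔p (free T (reading j a)) ρ)
    (depart≤arrive (reading j a) i ρ)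

  fifoHead-next : ∀ {m} σ (f : Vector File (suc m)) r {t} →
    start T σ (f zero) (r zero) ≤ t →
    fifoHead σ f r t ≡
      fifoHead (next T σ (f zero) (r zero)) (tail f) (tail r) t
  fifoHead-next initial f r h =
    goRead-onwards initial (f zero) (r zero)
      (onward initial f r) (onward-left initial f r) h
  fifoHead-next (reading j a) f r h with j Fin.≟ f zero ×-dec r zero ≤? a
  ... | yes (refl , _) = refl
  ... | no  _ = goRead-onwards (reading j a) (f zero) (r zero)
      (onward (reading j a) f r) (onward-left (reading j a) f r) h

  rest-end : ∀ i a → rest (reading i a) (a + width T i) ≡ right T i
  rest-end i a = rest-free (reading i a) ≤-refl

  p≤p+width : ∀ p i → p ≤ p + width T i
  p≤p+width p i = p≤p+q p (0≤fromℕ (size i))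

  fifo-reads : ∀ {m} σ (f : Vector File m) r k →
    let t = fifoService T σ f r k in
    begin σ ≤ t ×
    fifoHead σ f r t ≡ left T (f k) ×
    fifoHead σ f r (t + width T (f k)) ≡ right T (f k)
  fifo-reads σ f r zero =
    begin≤start σ (f zero) (r zero) ,
    trans (fifoHead-next σ f r ≤-refl) (fifoHead-begin (f zero) s _ (tail r)) ,
    trans (fifoHead-next σ f r (p≤p+width s (f zero)))
      (trans (fifoHead-rest (reading (f zero) s) (tail f) (tail r) ≤-refl)
        (rest-end (f zero) s))
    where s = start T σ (f zero) (r zero)
  fifo-reads σ f r (suc k)
    with fifo-reads (next T σ (f zero) (r zero)) (tail f) (tail r) k
  ... | h , l , e =
    ≤-trans (begin≤start σ (f zero) (r zero)) h ,
    trans (fifoHead-next σ f r h) l ,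
    trans (fifoHead-next σ f r (≤-trans h (p≤p+width t (f (suc k))))) e
    where t = fifoService T σ f r (suc k)

  fullSpeed⇒Reads : ∀ {x head i t} → Slow x head → x ≤ t →
    head t ≡ left T i → head (t + width T i) ≡ right T i → Reads T head i t
  fullSpeed⇒Reads {x} {head} {i} {t} s x≤t l r =
    t + width T i , p≤p+width t i , l , r , strict
    where
    strict : ∀ {u v} → t ≤ u → u < v → v ≤ t + width T i → head u < head v
    strict {u} {v} t≤u u<v v≤e = ≤-<-trans
      (subst (λ y → head u ≤ y + (u - t)) l (proj₁ (s x≤t t≤u)))
      (<-≤-trans
        (+-monoʳ-< (left T i) (+-monoˡ-< (- t) u<v))
        (ahead (left T i) (width T i) (head v) t v
          (subst (_≤ head v + (t + width T i - v)) r
            (proj₁ (s (≤-trans x≤t (≤-trans t≤u (<⇒≤ u<v))) v≤e)))))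

  fifo-released : ∀ {m} σ (f : Vector File m) r k →
    r k ≤ fifoService T σ f r k
  fifo-released σ f r zero    = release≤start σ (f zero) (r zero)
  fifo-released σ f r (suc k) =
    fifo-released (next T σ (f zero) (r zero)) (tail f) (tail r) k

  -- FIFO services the requests in their order of arrival.
  fifoService-mono : ∀ {m} σ (f : Vector File m) r {j k} → j Fin.≤ k →
    fifoService T σ f r j ≤ fifoService T σ f r k
  fifoService-mono σ f r {zero}  {zero}  _ = ≤-refl
  fifoService-mono σ f r {zero}  {suc k} _ =
    proj₁ (fifo-reads (next T σ (f zero) (r zero)) (tail f) (tail r) k)
  fifoService-mono σ f r {suc j} {suc k} (ℕ.s≤s h) =
    fifoService-mono (next T σ (f zero) (r zero)) (tail f) (tail r) h

fifo : Policy
fifo I = record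
  { head             = fifoHead tape initial file release
  ; head-initial     = fifoHead-rest tape initial file release ≤-refl
  ; head-speed       = slow⇒∣∣ (slow-fifoHead tape initial file release)
  ; service          = fifoService tape initial file release
  ; service-released = fifo-released tape initial file release
  ; service-reads    = λ k → let t , l , e = fifo-reads tape initial file release k in
      fullSpeed⇒Reads tape (slow-fifoHead tape initial file release) t l e
  }
  where open Instance I

{-# OPTIONS --safe #-}
-- On a tape of two unit files, let the files be requested alternately, m
-- times in all and all at time 0.  FIFO makes a new reading for each request,
-- at a total cost quadratic in m, whereas reading each file once services
-- every request by time 3.

module Submission where

open import Data.Fin using (Fin; zero; suc; opposite)
import Data.Fin as Fin
import Data.Integer as ℤ
import Data.Integer.Properties as ℤ
open import Data.Nat using (ℕ; zero; suc; s≤s; z≤n)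
import Data.Nat.Properties as ℕ
open import Data.Product using (_,_; ∃-syntax)
open import Data.Rational using (ℚ; 0ℚ; 1ℚ; _+_; _*_; _≤_; _<_; *≤*; ↥_; nonNegative)
open import Data.Rational.Properties
import Data.Rational.Unnormalised as ℚᵘ
import Data.Rational.Unnormalised.Properties as ℚᵘ
open import Data.Rational.Solver using (module +-*-Solver)
open import Data.Vec.Functional using (Vector; tail)
open import Relation.Binary.PropositionalEquality
open import Relation.Nullary using (¬_; yes; no; contradiction)
open import Relation.Nullary.Decidable using (from-yes; _×-dec_)
open import Defs hiding (begin)

open +-*-Solver using (solve; con; _:+_; _:*_; _:=_)

fromℕ-suc : ∀ n → fromℕ (suc n) ≡ 1ℚ + fromℕ n
fromℕ-suc n = toℚᵘ-injective (ℚᵘ.≃-sym (ℚᵘ.≃-trans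
  (toℚᵘ-homo-+ 1ℚ (fromℕ n))
  (ℚᵘ.*≡* (cong (λ z → (ℤ.1ℤ ℤ.+ z) ℤ.* ℤ.1ℤ) (ℤ.*-identityʳ (ℤ.+ n))))))

-- The denominator is at least 1, so the absolute value of the numerator is a bound.
archimedean : ∀ p → ∃[ n ] p ≤ fromℕ n
archimedean p = ℤ.∣ ↥ p ∣ , *≤* (ℤ.≤-trans
  (ℤ.≤-reflexive (ℤ.*-identityʳ (↥ p)))
  (ℤ.≤-trans (i≤∣i∣ (↥ p))
    (ℤ.≤-trans (ℤ.+≤+ (ℕ.m≤m*n _ _)) (ℤ.≤-reflexive (ℤ.pos-* ℤ.∣ ↥ p ∣ _)))))
  where
  i≤∣i∣ : ∀ i → i ℤ.≤ ℤ.+ ℤ.∣ i ∣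
  i≤∣i∣ (ℤ.+ n)      = ℤ.≤-refl
  i≤∣i∣ (ℤ.-[1+ n ]) = ℤ.-≤+

sum-≤ : ∀ {m} (f : Vector ℚ m) b → (∀ k → f k ≤ b) → sum f ≤ fromℕ m * b
sum-≤ {zero}  f b h = ≤-reflexive (sym (*-zeroˡ b))
sum-≤ {suc m} f b h = ≤-trans
  (+-mono-≤ (h zero) (sum-≤ (tail f) b (λ k → h (suc k))))
  (≤-reflexive (trans
    (solve 2 (λ b p → b :+ p :* b := (con 1ℚ :+ p) :* b) refl b (fromℕ m))
    (cong (_* b) (sym (fromℕ-suc m)))))

sum-≥0 : ∀ {m} (f : Vector ℚ m) → (∀ k → 0ℚ ≤ f k) → 0ℚ ≤ sum f
sum-≥0 {zero}  f h = ≤-refl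
sum-≥0 {suc m} f h = +-mono-≤ (h zero) (sum-≥0 (tail f) (λ k → h (suc k)))

-- A reading of another file cannot be shared, so a new one is made once the head is free.
free≤start : ∀ T {i j} a ρ → j ≢ i →
  free T (reading j a) ≤ start T (reading j a) i ρ
free≤start T {i} {j} a ρ j≢i with j Fin.≟ i ×-dec ρ ≤? a
... | yes (j≡i , _) = contradiction j≡i j≢i
... | no  _         = ≤-trans (free≤depart T (reading j a) i ρ)
  (depart≤arrive T (reading j a) i ρ)

twoFiles : Tape
twoFiles = record { #files = 2 ; size = λ _ → 1 ; size>0 = λ _ → s≤s z≤n }

-- On `Fin 2`, `opposite` swaps the files. The recursion follows that of `fifoService`: the tail is
-- again alternating, by computation.
alternate : Fin 2 → ∀ {m} → Vector (Fin 2) m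
alternate i zero    = i
alternate i (suc k) = alternate (opposite i) k

≢opposite : (i : Fin 2) → i ≢ opposite i
≢opposite zero       ()
≢opposite (suc zero) ()

allAtZero : ∀ {m} → Vector (Fin 2) m → Instance
allAtZero f = record
  { tape         = twoFiles
  ; #requests    = _
  ; file         = f
  ; release      = λ _ → 0ℚ
  ; release≥0    = λ _ → ≤-refl
  ; release-mono = λ _ → ≤-refl
  }

-- The most recent reading is a parameter, so that induction on `m` can move on to the next one.
alternateService : ∀ m → Fin 2 → ℚ → Vector ℚ m
alternateService m j a =
  fifoService twoFiles (reading j a) (alternate (opposite j)) (λ _ → 0ℚ)

-- The k-th service, k = 1, …, m, starts at a + k or later.
alternateService-sum : ∀ m j a →
  fromℕ m * (a + a + fromℕ m) ≤
    sum (alternateService m j a) + sum (alternateService m j a)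
alternateService-sum zero    j a = ≤-reflexive (*-zeroˡ (a + a + 0ℚ))
alternateService-sum (suc m) j a = begin
  fromℕ (suc m) * (a + a + fromℕ (suc m))
    ≡⟨ cong (λ q → q * (a + a + q)) (fromℕ-suc m) ⟩
  (1ℚ + p) * (a + a + (1ℚ + p))
    -- The lower bounds a + k add up, doubled, to m (2a + m + 1); the claim gives away m, one unit
    -- per request. This is the unit.
    ≤⟨ p≤p+q _ (from-yes (0ℚ ≤? 1ℚ)) ⟩
  (1ℚ + p) * (a + a + (1ℚ + p)) + 1ℚ
    ≡⟨ solve 2 (λ a p →
         (con 1ℚ :+ p) :* (a :+ a :+ (con 1ℚ :+ p)) :+ con 1ℚ :=
         (con 1ℚ :+ p) :* ((a :+ con 1ℚ) :+ (a :+ con 1ℚ)) :+ p :* p)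
         refl a p ⟩
  (1ℚ + p) * ((a + 1ℚ) + (a + 1ℚ)) + p * p
    ≤⟨ +-monoˡ-≤ (p * p) (*-monoˡ-≤-nonNeg (1ℚ + p) {{nonNegative 0≤1+p}}
         (+-mono-≤ a+1≤s a+1≤s)) ⟩
  (1ℚ + p) * (s + s) + p * p
    ≡⟨ solve 2 (λ s p →
         (con 1ℚ :+ p) :* (s :+ s) :+ p :* p :=
         (s :+ s) :+ p :* (s :+ s :+ p)) refl s p ⟩
  (s + s) + p * (s + s + p)
    ≤⟨ +-monoʳ-≤ (s + s) (alternateService-sum m (opposite j) s) ⟩
  (s + s) + (r + r)
    ≡⟨ solve 2 (λ s r → (s :+ s) :+ (r :+ r) := (s :+ r) :+ (s :+ r))
         refl s r ⟩
  (s + r) + (s + r) ∎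
  where
  open ≤-Reasoning hiding (start)
  p = fromℕ m
  s = start twoFiles (reading j a) (opposite j) 0ℚ
  r = sum (alternateService m (opposite j) s)
  a+1≤s : a + 1ℚ ≤ s
  -- Files have width 1, so `free` computes to `a + 1ℚ`; travel time is ignored.
  a+1≤s = free≤start twoFiles a 0ℚ (≢opposite j)
  0≤1+p : 0ℚ ≤ 1ℚ + p
  0≤1+p = subst (0ℚ ≤_) (fromℕ-suc m) (0≤fromℕ (suc m))

-- The first request serves to start the alternation; its own cost and its start `s` are bounded
-- below by 0.
fifo-alternate : ∀ n →
  let z = Schedule.objective (fifo (allAtZero (alternate zero {suc n}))) in
  fromℕ n * fromℕ n ≤ z + z
fifo-alternate n = begin
  p * p
    ≤⟨ *-monoˡ-≤-nonNeg p {{nonNegative (0≤fromℕ n)}}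
         (subst (_≤ s + s + p) (+-identityˡ p)
           (+-monoˡ-≤ p (+-mono-≤ 0≤s 0≤s))) ⟩
  p * (s + s + p)   ≤⟨ alternateService-sum n zero s ⟩
  r + r             ≤⟨ +-mono-≤ r≤s+r r≤s+r ⟩
  (s + r) + (s + r) ∎
  where
  open ≤-Reasoning hiding (start)
  p = fromℕ n
  s = start twoFiles initial zero 0ℚ
  r = sum (alternateService n zero s)
  0≤s : 0ℚ ≤ s
  0≤s = begin≤start twoFiles initial zero 0ℚ
  r≤s+r : r ≤ s + r
  r≤s+r = subst (_≤ s + r) (+-identityˡ r) (+-monoˡ-≤ r 0≤s)

-- FIFO itself supplies the cheap motion: from 2 back to 0, then one sweep to the right, with
-- readings at times 2 and 3.
eachFileOnce : Schedule (allAtZero {2} (λ i → i))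
eachFileOnce = fifo (allAtZero (λ i → i))

-- All releases are at 0, so one reading of a file can service every request for it.
readEachOnce : ∀ {m} (f : Vector (Fin 2) m) → Schedule (allAtZero f)
readEachOnce f = record
  { head             = head
  ; head-initial     = head-initial
  ; head-speed       = head-speed
  ; service          = λ k → service (f k)
  ; service-released = λ k → service-released (f k)
  ; service-reads    = λ k → service-reads (f k)
  }
  where open Schedule eachFileOnce

2ℚ 3ℚ 6ℚ 12ℚ : ℚ
2ℚ  = fromℕ 2
3ℚ  = fromℕ 3
6ℚ  = fromℕ 6
12ℚ = fromℕ 12

eachFileOnce≤3 : ∀ i → Schedule.service eachFileOnce i ≤ 3ℚ
eachFileOnce≤3 zero       =
  from-yes (Schedule.service eachFileOnce zero ≤? 3ℚ)
eachFileOnce≤3 (suc zero) =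
  from-yes (Schedule.service eachFileOnce (suc zero) ≤? 3ℚ)

-- With 12 c ≤ q and p = 1 + q, the costs z of FIFO and y of reading each file
-- once on p + 1 requests would satisfy 6 p² ≤ 12 z ≤ 12 c y ≤ 3 q (p + 1) < 6 p².
proposition6 : ∀ (c : ℚ) → ¬ Competitive c fifo
proposition6 c competitive with archimedean (12ℚ * c)
... | n , 12c≤q = <-irrefl refl (begin-strict
  6ℚ * (p * p)
    ≤⟨ *-monoˡ-≤-nonNeg 6ℚ (fifo-alternate (suc n)) ⟩
  6ℚ * (z + z)
    ≡⟨ solve 1 (λ z → con 6ℚ :* (z :+ z) := con 12ℚ :* z) refl z ⟩
  12ℚ * z
    ≤⟨ *-monoˡ-≤-nonNeg 12ℚ (competitive I S) ⟩
  12ℚ * (c * y)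
    ≡⟨ *-assoc 12ℚ c y ⟨
  (12ℚ * c) * y
    ≤⟨ *-monoʳ-≤-nonNeg y {{nonNegative 0≤y}} 12c≤q ⟩
  q * y
    ≤⟨ *-monoˡ-≤-nonNeg q {{nonNegative (0≤fromℕ n)}}
         (sum-≤ (Schedule.service S) 3ℚ (λ k → eachFileOnce≤3 (file k))) ⟩
  q * (fromℕ (suc (suc n)) * 3ℚ)
    ≡⟨ cong (λ x → q * (x * 3ℚ))
         (trans (fromℕ-suc (suc n)) (cong (1ℚ +_) (fromℕ-suc n))) ⟩
  q * ((1ℚ + (1ℚ + q)) * 3ℚ)
    -- 6 (1 + q)² exceeds 3 q (q + 2) by 6 + 3 q (q + 2); the 6 gives strictness even for q = 0.
    <⟨ p<p+6 _ ⟩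
  q * ((1ℚ + (1ℚ + q)) * 3ℚ) + 6ℚ
    ≤⟨ p≤p+q _ 0≤rest ⟩
  q * ((1ℚ + (1ℚ + q)) * 3ℚ) + 6ℚ + 3ℚ * (q * (q + 2ℚ))
    ≡⟨ solve 1 (λ q →
         q :* ((con 1ℚ :+ (con 1ℚ :+ q)) :* con 3ℚ) :+ con 6ℚ :+
           con 3ℚ :* (q :* (q :+ con 2ℚ)) :=
         con 6ℚ :* ((con 1ℚ :+ q) :* (con 1ℚ :+ q))) refl q ⟩
  6ℚ * ((1ℚ + q) * (1ℚ + q))
    ≡⟨ cong (λ x → 6ℚ * (x * x)) (fromℕ-suc n) ⟨
  6ℚ * (p * p) ∎)
  where
  open ≤-Reasoning hiding (start)
  q = fromℕ n
  p = fromℕ (suc n)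
  -- One request more than `p`, since `fifo-alternate` counts those after the first.
  file = alternate zero {suc (suc n)}
  I = allAtZero file
  S = readEachOnce file
  z = Schedule.objective (fifo I)
  y = Schedule.objective S
  0≤y : 0ℚ ≤ y
  0≤y = sum-≥0 (Schedule.service S) (Schedule.service-released S)
  p<p+6 : ∀ p → p < p + 6ℚ
  p<p+6 p = subst (_< p + 6ℚ) (+-identityʳ p)
    (+-monoʳ-< p (from-yes (0ℚ <? 6ℚ)))
  0≤rest : 0ℚ ≤ 3ℚ * (q * (q + 2ℚ))
  0≤rest = *-monoˡ-≤-nonNeg 3ℚ (subst (_≤ q * (q + 2ℚ)) (*-zeroʳ q)
    (*-monoˡ-≤-nonNeg q {{nonNegative (0≤fromℕ n)}}
      (+-mono-≤ (0≤fromℕ n) (0≤fromℕ 2))))
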